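{- For every integer $m\ge1$ there exists an explicit $K_4$-free graph $G_m$ on $20m+31$ vertices such that: (1) $\chi(G_m)=4$; (2) every proper subgraph $H\subsetneq G_m$ is $3$-colorable (in fact $2$-degenerate); (3) every cycle $C$ in $G_m$ satisfies $\operatorname{ch}_{G_m}(C)\le 10$.
   Context: For a graph $G$ and a cycle $C\subseteq G$, $\operatorname{ch}_G(C)$ is the number of edges of $G$ joining two vertices of $C$ that are not consecutive on $C$ (chords). A graph is $2$-degenerate if every nonempty subgraph has a vertex of degree at most $2$. -}

module Defs where

open import Data.Nat using (ℕ; zero; suc; _+_; _*_; _∸_; _≤_; _<_; _≡ᵇ_; _<ᵇ_)
open import Data.Fin using (Fin; toℕ)
open import Data.Bool using (Bool; true; false; _∧_; _∨_; not)
open import Data.List using (List; length; filterᵇ; allFin; map)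
open import Data.Nat.ListAction using (sum)
open import Data.Product using (Σ; ∃; _×_; _,_)
open import Data.Sum using (_⊎_)
open import Relation.Binary.PropositionalEquality using (_≡_; _≢_)
open import Relation.Nullary using (¬_)

record Graph (n : ℕ) : Set where
  field
    adj    : Fin n → Fin n → Bool
    sym    : ∀ u v → adj u v ≡ adj v u
    irrefl : ∀ v → adj v v ≡ false
open Graph public

record Subgraph {n : ℕ} (G : Graph n) : Set where
  field
    vs     : Fin n → Bool
    es     : Fin n → Fin n → Bool
    es-sym : ∀ u v → es u v ≡ es v u
    es⊆E   : ∀ u v → es u v ≡ true → adj G u v ≡ true
    es-end : ∀ u v → es u v ≡ true → vs u ≡ true
open Subgraph public

_⊑_ : ∀ {n} {G : Graph n} → Subgraph G → Subgraph G → Set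
H' ⊑ H = (∀ v → vs H' v ≡ true → vs H v ≡ true)
       × (∀ u v → es H' u v ≡ true → es H u v ≡ true)

ProperSubgraph : ∀ {n} (G : Graph n) → Subgraph G → Set
ProperSubgraph G H = (∃ λ v → vs H v ≡ false)
                   ⊎ (∃ λ u → ∃ λ v → adj G u v ≡ true × es H u v ≡ false)

NonEmpty : ∀ {n} {G : Graph n} → Subgraph G → Set
NonEmpty H = ∃ λ v → vs H v ≡ true

degree : ∀ {n} {G : Graph n} → Subgraph G → Fin n → ℕ
degree {n} H v = length (filterᵇ (es H v) (allFin n))

TwoDegenerate : ∀ {n} {G : Graph n} → Subgraph G → Set
TwoDegenerate {G = G} H =
  ∀ (H' : Subgraph G) → H' ⊑ H → NonEmpty H' →
    ∃ λ v → vs H' v ≡ true × degree H' v ≤ 2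

ColorableRel : ∀ {n} → ℕ → (Fin n → Fin n → Bool) → Set
ColorableRel {n} k E = Σ (Fin n → Fin k) λ c → ∀ u v → E u v ≡ true → c u ≢ c v

Colorable : ∀ {n} → Graph n → ℕ → Set
Colorable G k = ColorableRel k (adj G)

SubColorable : ∀ {n} {G : Graph n} → Subgraph G → ℕ → Set
SubColorable H k = ColorableRel k (es H)

HasChromaticNumber : ∀ {n} → Graph n → ℕ → Set
HasChromaticNumber G k = Colorable G k × (∀ j → j < k → ¬ Colorable G j)

K4Free : ∀ {n} → Graph n → Set
K4Free {n} G = ¬ (Σ (Fin n) λ a → Σ (Fin n) λ b → Σ (Fin n) λ c → Σ (Fin n) λ d →
  adj G a b ≡ true × adj G a c ≡ true × adj G a d ≡ true ×
  adj G b c ≡ true × adj G b d ≡ true × adj G c d ≡ true)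

isNext : (len : ℕ) → Fin len → Fin len → Bool
isNext len i j = (suc (toℕ i) ≡ᵇ toℕ j) ∨ ((suc (toℕ i) ≡ᵇ len) ∧ (toℕ j ≡ᵇ 0))

consecutive : (len : ℕ) → Fin len → Fin len → Bool
consecutive len i j = isNext len i j ∨ isNext len j i

record Cycle {n : ℕ} (G : Graph n) : Set where
  field
    len   : ℕ
    len≥3 : 3 ≤ len
    vert  : Fin len → Fin n
    inj   : ∀ i j → vert i ≡ vert j → i ≡ j
    edges : ∀ i j → isNext len i j ≡ true → adj G (vert i) (vert j) ≡ true
open Cycle public

chords : ∀ {n} (G : Graph n) → Cycle G → ℕ
chords G C = sum (map (λ i → length (filterᵇ (λ j →
    (toℕ i <ᵇ toℕ j) ∧ adj G (vert C i) (vert C j) ∧ not (consecutive (len C) i j))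
    (allFin (len C)))) (allFin (len C)))

{-# OPTIONS --safe #-}

-- G is a wheel whose spokes are replaced by gadgets: the rim is an odd cycle, each
-- rim vertex s is joined to the tip (s, 0) of its own odd cycle (s, 0), (s, 1), … of
-- length 3 or 5, and all non-tips (s, j), j > 0, are joined to the hub.
-- In a 3-colouring every odd cycle uses the hub's colour; on a gadget only the tip can,
-- so no rim vertex can, although the rim is odd.
-- Every vertex except the hub has degree 3 and these vertices are connected, so a
-- subgraph of minimum degree 3 is all of G. Hence proper subgraphs are 2-degenerate and,
-- colouring greedily, 3-colourable; deleting the hub yields a 4-colouring of G, and
-- deleting a vertex off a K₄ would 3-colour the K₄.
-- If a cycle C has a chord at a non-hub vertex x, then all three neighbours of x lie on
-- C, so C meets both the gadget at x's spoke and its complement; it crosses between them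
-- twice, at most once via the tip, so the gadget contains one of the two neighbours of
-- the hub on C. Hence only two spokes carry chords. Every chord ends in one of their at
-- most 5 + 5 rim or non-tip vertices, and each of these, having degree 3, is on at most
-- one chord.
module Submission where

open import Axiom.UniquenessOfIdentityProofs using (module Decidable⇒UIP)
open import Data.Bool using (Bool; true; false; _∧_; not; T?)
open import Data.Bool.Properties using (∧-comm; ∨-comm; not-involutive; T-≡) renaming (_≟_ to _≟ᵇ_)
open import Data.Empty using (⊥; ⊥-elim)
open import Data.Fin using (Fin; zero; suc; toℕ; fromℕ; inject₁; inject≤)
open import Data.Fin.Induction using (<-weakInduction; >-weakInduction)
open import Data.Fin.Properties
  using (_≟_; any?; toℕ-fromℕ; toℕ-inject₁; fromℕ≢inject₁; inject₁-injective; inject≤-injective; 1↔⊤; +↔⊎)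
open import Data.Fin.Relation.Unary.Top using (view; view-fromℕ; view-inject₁; ‵fromℕ; ‵inject₁)
open import Data.List
  using (List; []; _∷_; _++_; length; map; allFin; filterᵇ; cartesianProduct; tabulate)
import Data.List.Membership.DecPropositional as DecMembership
open import Data.List.Membership.Propositional using (_∈_; _∉_)
open import Data.List.Membership.Propositional.Properties
  using (∈-∃++; ∈-++⁺ˡ; ∈-++⁺ʳ; ∈-++⁻; ∈-filter⁺; ∈-filter⁻; ∈-allFin; ∈-map⁺; ∈-map⁻)
open import Data.List.Properties using (length-++; length-map; length-tabulate; filter-++)
import Data.List.Relation.Unary.All as All
open All using ([]; _∷_)
open import Data.List.Relation.Unary.All.Properties using (¬Any⇒All¬)
open import Data.List.Relation.Unary.AllPairs using ([]; _∷_)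
open import Data.List.Relation.Unary.Any using (here; there)
open import Data.List.Relation.Unary.Unique.Propositional using (Unique)
open import Data.List.Relation.Unary.Unique.Propositional.Properties
  using (allFin⁺; filter⁺; cartesianProduct⁺)
open import Data.Nat
  using (ℕ; zero; suc; _+_; _*_; _≤_; _<_; _<ᵇ_; _≤?_; z≤n; s≤s; s≤s⁻¹)
open import Data.Nat.Divisibility using (_∣_; divides)
open import Data.Nat.GeneralisedArithmetic using (fold)
open import Data.Nat.ListAction using (sum)
open import Data.Nat.Properties
  using (≤-refl; ≤-reflexive; ≤-trans; <-asym; <⇒≱; ≰⇒>; <ᵇ⇒<; ≡⇒≡ᵇ; +-suc; *-assoc; +-mono-≤; m≤n+m)
open import Data.Nat.Solver using (module +-*-Solver)
open import Data.Product using (Σ; ∃; _×_; _,_; proj₁; proj₂; uncurry)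
import Data.Product.Properties as Product
open import Data.Sum using (_⊎_; inj₁; inj₂)
open import Data.Sum.Function.Propositional using (_⊎-↔_)
open import Data.Sum.Properties using (inj₁-injective; inj₂-injective) renaming (≡-dec to ⊎-≡-dec)
open import Data.Unit using (⊤; tt)
import Data.Unit.Properties as Unit
open import Defs hiding (sym)
open import Function using (_∘_; _↔_; Equivalence; Inverse; mk↔ₛ′)
open import Function.Properties.Inverse using (↔-refl; ↔-trans)
open import Relation.Binary.Definitions using (DecidableEquality)
open import Relation.Binary.PropositionalEquality
  using (_≡_; _≢_; refl; sym; trans; cong; cong₂; subst; subst₂; ≢-sym)
open import Relation.Nullary
  using (¬_; Dec; yes; no; ¬?; _×-dec_; ⌊_⌋; contradiction; decidable-stable)
open import Relation.Unary using (Decidable)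

-- Pigeonhole for duplicate-free lists.

module _ {A B : Set} {R : A → B → Set} (R-inj : ∀ {x x′ y} → R x y → R x′ y → x ≡ x′) where

  -- Cutting the partner `y` of the head out of `ys` costs one element on each side; injectivity
  -- keeps the partners of the remaining elements. A relation in place of a function lets a chord be
  -- charged to either of its ends.
  unique-length-≤ : ∀ {xs} ys → Unique xs → (∀ {x} → x ∈ xs → ∃ λ y → y ∈ ys × R x y) →
                    length xs ≤ length ys
  unique-length-≤ {[]}     ys _           _   = z≤n
  unique-length-≤ {x ∷ xs} ys (x∉xs ∷ uq) rel with rel (here refl)
  ... | y , y∈ys , xRy with ∈-∃++ y∈ys
  ...   | as , bs , refl =
    ≤-trans (s≤s (unique-length-≤ (as ++ bs) uq rel′))
            (≤-reflexive (trans (cong suc (length-++ as))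
              (trans (sym (+-suc (length as) (length bs))) (sym (length-++ as)))))
    where
    rel′ : ∀ {x′} → x′ ∈ xs → ∃ λ y′ → y′ ∈ as ++ bs × R x′ y′
    rel′ x′∈ with rel (there x′∈)
    ... | y′ , y′∈ , x′Ry′ with ∈-++⁻ as y′∈
    ...   | inj₁ ∈as         = y′ , ∈-++⁺ˡ ∈as , x′Ry′
    ...   | inj₂ (there ∈bs) = y′ , ∈-++⁺ʳ as ∈bs , x′Ry′
    ...   | inj₂ (here refl) = ⊥-elim (All.lookup x∉xs x′∈ (R-inj xRy x′Ry′))

Unique-⊆⇒length-≤ : {A : Set} {xs ys : List A} → Unique xs → (∀ {x} → x ∈ xs → x ∈ ys) →
                    length xs ≤ length ys
Unique-⊆⇒length-≤ uq xs⊆ys =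
  unique-length-≤ {R = _≡_} (λ p q → trans p (sym q)) _ uq (λ x∈ → _ , xs⊆ys x∈ , refl)

∉⇒Unique-∷ : {A : Set} {x : A} {xs : List A} → x ∉ xs → Unique xs → Unique (x ∷ xs)
∉⇒Unique-∷ x∉xs uq = ¬Any⇒All¬ _ x∉xs ∷ uq

fresh : ∀ {k} (xs : List (Fin k)) → length xs < k → ∃ λ i → i ∉ xs
fresh {k} xs short with any? (λ i → ¬? (i ∈? xs))
  where open DecMembership (_≟_ {k}) using (_∈?_)
... | yes found = found
... | no  none  = contradiction
  (≤-trans (≤-reflexive (sym (length-tabulate {n = k} (λ i → i))))
           (Unique-⊆⇒length-≤ (allFin⁺ k) (λ {i} _ → decidable-stable (i ∈? xs) (λ i∉ → none (i , i∉)))))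
  (<⇒≱ short)
  where open DecMembership (_≟_ {k}) using (_∈?_)

module _ {n : ℕ} (p : Fin n → Bool) where

  ∈-filterᵇ⁺ : ∀ {i} → p i ≡ true → i ∈ filterᵇ p (allFin n)
  ∈-filterᵇ⁺ {i} eq = ∈-filter⁺ (T? ∘ p) (∈-allFin i) (Equivalence.from T-≡ eq)

  ∈-filterᵇ⁻ : ∀ {i} → i ∈ filterᵇ p (allFin n) → p i ≡ true
  ∈-filterᵇ⁻ i∈ = Equivalence.to T-≡ (proj₂ (∈-filter⁻ (T? ∘ p) {xs = allFin n} i∈))

  filterᵇ-Unique : Unique (filterᵇ p (allFin n))
  filterᵇ-Unique = filter⁺ (T? ∘ p) (allFin⁺ n)

-- Cyclic successor and odd cycles.

next : ∀ {n} → Fin (suc n) → Fin (suc n)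
next i with view i
... | ‵fromℕ     = zero
... | ‵inject₁ j = suc j

prev : ∀ {n} → Fin (suc n) → Fin (suc n)
prev zero    = fromℕ _
prev (suc i) = inject₁ i

next-fromℕ : ∀ n → next (fromℕ n) ≡ zero
next-fromℕ n rewrite view-fromℕ n = refl

next-inject₁ : ∀ {n} (i : Fin n) → next (inject₁ i) ≡ suc i
next-inject₁ i rewrite view-inject₁ i = refl

next-prev : ∀ {n} (i : Fin (suc n)) → next (prev i) ≡ i
next-prev zero    = next-fromℕ _
next-prev (suc i) = next-inject₁ i

prev-next : ∀ {n} (i : Fin (suc n)) → prev (next i) ≡ i
prev-next i with view i
... | ‵fromℕ     = refl
... | ‵inject₁ j = refl

next-injective : ∀ {n} {i j : Fin (suc n)} → next i ≡ next j → i ≡ j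
next-injective eq = trans (sym (prev-next _)) (trans (cong prev eq) (prev-next _))

module _ {n : ℕ} (P : Fin (suc n) → Set) (step : ∀ i → P i → P (next i)) where

  -- Climb from `i` to the last index, wrap around to `zero`, then climb to `j`.
  next-closed : ∀ i j → P i → P j
  next-closed i j Pi = <-weakInduction P P0 (λ k → subst P (next-inject₁ k) ∘ step _) j
    where
    P0 : P zero
    P0 = >-weakInduction (λ k → P k → P zero)
           (λ Pk → subst P (next-fromℕ n) (step _ Pk))
           (λ k IH Pk → IH (subst P (next-inject₁ k) (step _ Pk))) i Pi

exit : ∀ {n} {P : Fin (suc n) → Set} → Decidable P → ∀ i j → P i → ¬ P j →
       ∃ λ k → P k × ¬ P (next k)
exit {P = P} P? i j Pi ¬Pj with any? (λ k → P? k ×-dec ¬? (P? (next k)))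
... | yes found = found
... | no  none  = contradiction
  (next-closed P (λ k Pk → decidable-stable (P? (next k)) (λ ¬P → none (k , Pk , ¬P))) i j Pi) ¬Pj

next≢id : ∀ {n} (i : Fin (2 + n)) → next i ≢ i
next≢id {n} i eq with next-closed (_≡ i) (λ k k≡i → trans (cong next k≡i) eq) i zero refl
                    | next-closed (_≡ i) (λ k k≡i → trans (cong next k≡i) eq) i (suc zero) refl
... | refl | ()

-- Otherwise `i` and `next i` would form a set closed under `next`, hence contain all of the at
-- least three indices.
next²≢id : ∀ {n} (i : Fin (3 + n)) → next (next i) ≢ i
next²≢id {n} i eq = contradiction
  (Unique-⊆⇒length-≤ {xs = zero ∷ suc zero ∷ suc (suc zero) ∷ []} {ys = i ∷ next i ∷ []}
    (((λ ()) ∷ (λ ()) ∷ []) ∷ ((λ ()) ∷ []) ∷ [] ∷ [])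
    (λ {j} _ → orbit j))
  λ { (s≤s (s≤s ())) }
  where
  orbit : ∀ j → j ∈ i ∷ next i ∷ []
  orbit j = next-closed (_∈ i ∷ next i ∷ [])
    (λ { k (here refl) → there (here refl) ; k (there (here refl)) → here eq }) i j (here refl)

fold-next : ∀ {n} (i : Fin (suc n)) → fold zero next (toℕ i) ≡ i
fold-next = <-weakInduction (λ i → fold zero next (toℕ i) ≡ i) refl
  (λ i IH → trans (cong (next ∘ fold zero next) (sym (toℕ-inject₁ i)))
              (trans (cong next IH) (next-inject₁ i)))

-- Avoiding one of three colours leaves two, which must alternate around the cycle.
odd-cycle-uses-every-colour : ∀ {n} → 2 ∣ n → (c : Fin (3 + n) → Fin 3) →
  (∀ i → c i ≢ c (next i)) → ∀ h → ∃ λ i → c i ≡ h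
odd-cycle-uses-every-colour {n} (divides q refl) c proper h with any? (λ i → c i ≟ h)
... | yes found = found
-- The last index is `2 + n`, which equals `suc q * 2`; being even, it carries the colour of `zero`,
-- its cyclic successor.
... | no  none  = ⊥-elim (proper last (trans (trans (cong c (sym last-fold)) (alternate (suc q)))
                                             (cong c (sym (next-fromℕ (2 + n))))))
  where
  avoid : ∀ i → c i ≢ h
  avoid i eq = none (i , eq)

  period : ∀ i → c (next (next i)) ≡ c i
  period i = decidable-stable (_ ≟ _) λ ne → contradiction
    (≤-trans (Unique-⊆⇒length-≤ {xs = c (next (next i)) ∷ c (next i) ∷ c i ∷ h ∷ []} {ys = allFin 3}
      ((≢-sym (proper _) ∷ ne ∷ avoid _ ∷ []) ∷ (≢-sym (proper _) ∷ avoid _ ∷ []) ∷ (avoid _ ∷ []) ∷ [] ∷ [])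
      (λ _ → ∈-allFin _)) ≤-refl)
    λ { (s≤s (s≤s (s≤s ()))) }

  alternate : ∀ k → c (fold zero next (k * 2)) ≡ c zero
  alternate zero    = refl
  alternate (suc k) = trans (period _) (alternate k)

  last : Fin (3 + n)
  last = fromℕ (2 + n)

  last-fold : fold zero next (2 + n) ≡ last
  last-fold = trans (cong (fold zero next) (sym (toℕ-fromℕ (2 + n)))) (fold-next last)

-- Vertex deletion and greedy colouring of subgraphs.

∧-true : ∀ {a b} → a ∧ b ≡ true → a ≡ true × b ≡ true
∧-true {true} {true} _ = refl , refl

false≢true : ∀ {b} → b ≡ false → b ≢ true
false≢true refl ()

⌊⌋-true⁻ : {A : Set} (A? : Dec A) → ⌊ A? ⌋ ≡ true → A
⌊⌋-true⁻ (yes a) _ = a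

⌊⌋-true⁺ : {A : Set} (A? : Dec A) → A → ⌊ A? ⌋ ≡ true
⌊⌋-true⁺ (yes _) _ = refl
⌊⌋-true⁺ (no ¬a) a = contradiction a ¬a

module _ {n : ℕ} {G : Graph n} where

  es-loop : ∀ (H : Subgraph G) v → es H v v ≢ true
  es-loop H v = false≢true (irrefl G v) ∘ es⊆E H v v

  es-end′ : ∀ (H : Subgraph G) u v → es H u v ≡ true → vs H v ≡ true
  es-end′ H u v uv = es-end H v u (trans (es-sym H v u) uv)

  whole : Subgraph G
  whole = record
    { vs = λ _ → true ; es = adj G ; es-sym = Graph.sym G
    ; es⊆E = λ _ _ uv → uv ; es-end = λ _ _ _ → refl }

  _-ᵛ_ : Subgraph G → Fin n → Subgraph G
  H -ᵛ v = record
    { vs     = λ u → vs H u ∧ other u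
    ; es     = λ u w → es H u w ∧ (other u ∧ other w)
    ; es-sym = λ u w → trans (cong (_∧ (other u ∧ other w)) (es-sym H u w))
                             (cong (es H w u ∧_) (∧-comm (other u) (other w)))
    ; es⊆E   = λ u w → es⊆E H u w ∘ proj₁ ∘ ∧-true
    ; es-end = λ u w uw → let e , o = ∧-true uw in
                 trans (cong (_∧ other u) (es-end H u w e)) (proj₁ (∧-true o)) }
    where
    other : Fin n → Bool
    other u = not ⌊ u ≟ v ⌋

  -ᵛ-⊑ : ∀ {H v} → (H -ᵛ v) ⊑ H
  -ᵛ-⊑ = (λ _ → proj₁ ∘ ∧-true) , (λ _ _ → proj₁ ∘ ∧-true)

  -ᵛ-vs : ∀ H v → vs (H -ᵛ v) v ≡ false
  -ᵛ-vs H v with vs H v | v ≟ v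
  ... | false | _      = refl
  ... | true  | yes _  = refl
  ... | true  | no v≢v = contradiction refl v≢v

  -ᵛ-es : ∀ {H v u w} → u ≢ v → w ≢ v → es H u w ≡ true → es (H -ᵛ v) u w ≡ true
  -ᵛ-es {v = v} {u} {w} u≢v w≢v uw with u ≟ v | w ≟ v
  ... | yes u≡v | _       = contradiction u≡v u≢v
  ... | no _    | yes w≡v = contradiction w≡v w≢v
  ... | no _    | no _    = trans (cong (_∧ true) uw) refl

  -- The old value of `c` at `v` is overwritten, so `c` need only be proper on the edges avoiding
  -- `v`. This serves both the greedy step and the addition of a fourth colour.
  extend-colouring : ∀ {k} H v (c : Fin n → Fin k) →
    (∀ u w → es (H -ᵛ v) u w ≡ true → c u ≢ c w) →
    ∀ a → (∀ u → es H v u ≡ true → c u ≢ a) → SubColorable H k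
  extend-colouring {k} H v c proper a a-free = c′ , proper′
    where
    c′ : Fin n → Fin k
    c′ u with u ≟ v
    ... | yes _ = a
    ... | no  _ = c u

    proper′ : ∀ u w → es H u w ≡ true → c′ u ≢ c′ w
    proper′ u w uw with u ≟ v | w ≟ v
    ... | yes refl | yes refl = ⊥-elim (es-loop H u uw)
    ... | yes refl | no _     = ≢-sym (a-free w uw)
    ... | no _     | yes refl = a-free u (trans (es-sym H w u) uw)
    ... | no u≢v   | no w≢v   = proper u w (-ᵛ-es {H} u≢v w≢v uw)

  TwoDegenerate-⊑ : ∀ {H′ H : Subgraph G} → H′ ⊑ H → TwoDegenerate H → TwoDegenerate H′
  TwoDegenerate-⊑ (v⊑ , e⊑) deg H″ (v⊑′ , e⊑′) =
    deg H″ ((λ v → v⊑ v ∘ v⊑′ v) , (λ u v → e⊑ u v ∘ e⊑′ u v))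

  order : Subgraph G → ℕ
  order H = length (filterᵇ (vs H) (allFin n))

  order-ᵛ : ∀ H v → vs H v ≡ true → order (H -ᵛ v) < order H
  order-ᵛ H v v∈H = Unique-⊆⇒length-≤
    (∉⇒Unique-∷ (false≢true (-ᵛ-vs H v) ∘ ∈-filterᵇ⁻ (vs (H -ᵛ v))) (filterᵇ-Unique (vs (H -ᵛ v))))
    λ { (here refl) → ∈-filterᵇ⁺ (vs H) v∈H
      ; (there x∈)  → ∈-filterᵇ⁺ (vs H) (proj₁ (∧-true (∈-filterᵇ⁻ (vs (H -ᵛ v)) x∈))) }

  -- Degeneracy applied to `H` itself gives a vertex with at most two neighbours. Colour the rest
  -- first; one of three colours is then free. The bound `k` on the order is the recursion measure.
  greedy : ∀ k (H : Subgraph G) → order H ≤ k → TwoDegenerate H → SubColorable H 3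
  greedy k H ord deg with any? (λ v → vs H v ≟ᵇ true)
  ... | no none = (λ _ → zero) , λ u v uv → contradiction (u , es-end H u v uv) none
  ... | yes ne with deg H ((λ _ v∈ → v∈) , (λ _ _ e → e)) ne
  greedy zero    H ord deg | yes ne | v , v∈H , _   = contradiction (≤-trans (order-ᵛ H v v∈H) ord) λ ()
  greedy (suc k) H ord deg | yes ne | v , v∈H , d≤2
    with greedy k (H -ᵛ v) (s≤s⁻¹ (≤-trans (order-ᵛ H v v∈H) ord)) (TwoDegenerate-⊑ {H -ᵛ v} {H} (-ᵛ-⊑ {H} {v}) deg)
  ... | c , proper = let a , a∉ = fresh (map c nbrs) (s≤s (≤-trans (≤-reflexive (length-map c nbrs)) d≤2)) in
    extend-colouring H v c proper a
      λ u vu cu≡a → a∉ (subst (_∈ map c nbrs) cu≡a (∈-map⁺ c (∈-filterᵇ⁺ (es H v) vu)))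
    where nbrs = filterᵇ (es H v) (allFin n)

  TwoDegenerate⇒3-colourable : ∀ (H : Subgraph G) → TwoDegenerate H → SubColorable H 3
  TwoDegenerate⇒3-colourable H = greedy (order H) H ≤-refl

-- Counting chords by charging them to vertices.

module _ {A B : Set} (p : A → B → Bool) where

  length-filterᵇ-map : ∀ x ys → length (filterᵇ (uncurry p) (map (x ,_) ys)) ≡ length (filterᵇ (p x) ys)
  length-filterᵇ-map x []       = refl
  length-filterᵇ-map x (y ∷ ys) with p x y
  ... | true  = cong suc (length-filterᵇ-map x ys)
  ... | false = length-filterᵇ-map x ys

  -- Turns the nested sum in `chords` into the length of a single list of pairs, to which the
  -- pigeonhole applies.
  sum-length-filterᵇ : ∀ xs ys → sum (map (λ x → length (filterᵇ (p x) ys)) xs)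
                               ≡ length (filterᵇ (uncurry p) (cartesianProduct xs ys))
  sum-length-filterᵇ []       ys = refl
  sum-length-filterᵇ (x ∷ xs) ys = trans
    (cong₂ _+_ (sym (length-filterᵇ-map x ys)) (sum-length-filterᵇ xs ys))
    (trans (sym (length-++ (filterᵇ (uncurry p) (map (x ,_) ys))))
           (cong length (sym (filter-++ (T? ∘ uncurry p) (map (x ,_) ys) (cartesianProduct xs ys)))))

isNext-next : ∀ {n} (i : Fin (suc n)) → isNext (suc n) i (next i) ≡ true
isNext-next {n} i with view i
... | ‵fromℕ rewrite toℕ-fromℕ n | Equivalence.to T-≡ (≡⇒≡ᵇ n n refl) = refl
... | ‵inject₁ j rewrite toℕ-inject₁ j | Equivalence.to T-≡ (≡⇒≡ᵇ (toℕ j) (toℕ j) refl) = refl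

module _ {n : ℕ} {G : Graph n} (C : Cycle G) where

  Chord : Fin (len C) → Fin (len C) → Set
  Chord i j = adj G (vert C i) (vert C j) ≡ true × consecutive (len C) i j ≡ false

  Chord-sym : ∀ {i j} → Chord i j → Chord j i
  Chord-sym {i} {j} (e , nc) =
    trans (Graph.sym G _ _) e , trans (∨-comm (isNext (len C) j i) (isNext (len C) i j)) nc

  -- Each chord is charged to an end lying in `Z`, and no vertex of `Z` is charged twice.
  chords-≤-length : (Z : List (Fin n)) →
    (∀ {i j} → Chord i j → vert C i ∈ Z ⊎ vert C j ∈ Z) →
    (∀ {k i j} → vert C k ∈ Z → Chord k i → Chord k j → i ≡ j) →
    chords G C ≤ length Z
  chords-≤-length Z cover unique = ≤-trans
    (≤-reflexive (sum-length-filterᵇ chordᵇ (allFin (len C)) (allFin (len C))))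
    (unique-length-≤ {R = R} R-inj Z
      (filter⁺ (T? ∘ uncurry chordᵇ) (cartesianProduct⁺ (allFin⁺ (len C)) (allFin⁺ (len C))))
      represent)
    where
    chordᵇ : Fin (len C) → Fin (len C) → Bool
    chordᵇ i j = (toℕ i <ᵇ toℕ j) ∧ adj G (vert C i) (vert C j) ∧ not (consecutive (len C) i j)

    -- The order, the chord and the membership in `Z` are stored in the relation because `R-inj` has
    -- no other source for them.
    R : Fin (len C) × Fin (len C) → Fin n → Set
    R (i , j) z = toℕ i < toℕ j × Chord i j × z ∈ Z × (vert C i ≡ z ⊎ vert C j ≡ z)

    R-inj : ∀ {x x′ z} → R x z → R x′ z → x ≡ x′
    R-inj {i , j} {i′ , j′} (i<j , ch , z∈ , inj₁ refl) (i′<j′ , ch′ , _ , inj₁ eq)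
      with refl ← inj C i′ i eq = cong (i ,_) (unique z∈ ch ch′)
    R-inj {i , j} {i′ , j′} (i<j , ch , z∈ , inj₂ refl) (i′<j′ , ch′ , _ , inj₂ eq)
      with refl ← inj C j′ j eq = cong (_, j) (unique z∈ (Chord-sym ch) (Chord-sym ch′))
    -- Charged at the lower end of one pair and the upper end of the other, both pairs would be the
    -- same chord listed in opposite orders.
    R-inj {i , j} {i′ , j′} (i<j , ch , z∈ , inj₁ refl) (i′<j′ , ch′ , _ , inj₂ eq)
      with refl ← inj C j′ i eq with refl ← unique z∈ ch (Chord-sym ch′) =
      contradiction i′<j′ (<-asym i<j)
    R-inj {i , j} {i′ , j′} (i<j , ch , z∈ , inj₂ refl) (i′<j′ , ch′ , _ , inj₁ eq)
      with refl ← inj C i′ j eq with refl ← unique z∈ (Chord-sym ch) ch′ =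
      contradiction i′<j′ (<-asym i<j)

    represent : ∀ {x} → x ∈ filterᵇ (uncurry chordᵇ) (cartesianProduct (allFin (len C)) (allFin (len C))) →
                ∃ λ z → z ∈ Z × R x z
    represent {i , j} x∈
      with i<j , rest ← ∧-true {toℕ i <ᵇ toℕ j} (Equivalence.to T-≡ (proj₂ (∈-filter⁻ (T? ∘ uncurry chordᵇ)
                          {xs = cartesianProduct (allFin (len C)) (allFin (len C))} x∈)))
      with e , nc ← ∧-true {adj G (vert C i) (vert C j)} rest = go (cover ch)
      where
      i<j′ : toℕ i < toℕ j
      i<j′ = <ᵇ⇒< (toℕ i) (toℕ j) (Equivalence.from T-≡ i<j)
      ch : Chord i j
      ch = e , trans (sym (not-involutive _)) (cong not nc)
      go : vert C i ∈ Z ⊎ vert C j ∈ Z → ∃ λ z → z ∈ Z × R (i , j) z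
      go (inj₁ z∈) = _ , z∈ , i<j′ , ch , z∈ , inj₁ refl
      go (inj₂ z∈) = _ , z∈ , i<j′ , ch , z∈ , inj₂ refl

-- The wheel with gadgets as spokes.

pattern hub     = inj₁ tt
pattern rim s   = inj₁ s
pattern gad s j = inj₂ (s , j)

-- The tip of the gadget at s is gad s zero; a gadget has length 3 + w s, the rim 3 + ρ.
module Wheel (ρ : ℕ) (w : Fin (3 + ρ) → ℕ) where

  -- The vertices other than the hub form a type of their own: exactly these have three neighbours,
  -- two on their own cycle and one, `mate`, off it.
  X : Set
  X = Fin (3 + ρ) ⊎ Σ (Fin (3 + ρ)) (λ s → Fin (3 + w s))

  V : Set
  V = ⊤ ⊎ X

  _≟ˣ_ : DecidableEquality X
  _≟ˣ_ = ⊎-≡-dec _≟_ (Product.≡-dec _≟_ _≟_)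

  _≟ᵛ_ : DecidableEquality V
  _≟ᵛ_ = ⊎-≡-dec Unit._≟_ _≟ˣ_

  gad-injective : ∀ {s} {i j : Fin (3 + w s)} → _≡_ {A = X} (gad s i) (gad s j) → i ≡ j
  gad-injective = Product.,-injectiveʳ-UIP (Decidable⇒UIP.≡-irrelevant _≟_) ∘ inj₂-injective

  succ : X → X
  succ (rim s)   = rim (next s)
  succ (gad s j) = gad s (next j)

  pre : X → X
  pre (rim s)   = rim (prev s)
  pre (gad s j) = gad s (prev j)

  mate : X → V
  mate (rim s)         = inj₂ (gad s zero)
  mate (gad s zero)    = inj₂ (rim s)
  mate (gad s (suc j)) = hub

  nbrs : X → List V
  nbrs x = inj₂ (succ x) ∷ inj₂ (pre x) ∷ mate x ∷ []

  -- Adjacency at a vertex of `X` is membership in a list of three, so degree arguments become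
  -- comparisons of list lengths.
  Adj : V → V → Set
  Adj hub      hub      = ⊥
  Adj hub      (inj₂ x) = mate x ≡ hub
  Adj (inj₂ x) v        = v ∈ nbrs x

  Adj⇒nbr : ∀ {u v x} → u ≡ inj₂ x → Adj u v → v ∈ nbrs x
  Adj⇒nbr refl a = a

  Adj? : ∀ u v → Dec (Adj u v)
  Adj? hub      hub      = no λ ()
  Adj? hub      (inj₂ x) = mate x ≟ᵛ hub
  Adj? (inj₂ x) v        = v ∈? nbrs x
    where open DecMembership _≟ᵛ_ using (_∈?_)

  succ-pre : ∀ x → succ (pre x) ≡ x
  succ-pre (rim s)   = cong rim (next-prev s)
  succ-pre (gad s j) = cong (gad s) (next-prev j)

  pre-succ : ∀ x → pre (succ x) ≡ x
  pre-succ (rim s)   = cong rim (prev-next s)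
  pre-succ (gad s j) = cong (gad s) (prev-next j)

  succ≢id : ∀ x → succ x ≢ x
  succ≢id (rim s)   eq = next≢id s (inj₁-injective eq)
  succ≢id (gad s j) eq = next≢id j (gad-injective eq)

  mate-involutive : ∀ {x y} → mate x ≡ inj₂ y → mate y ≡ inj₂ x
  mate-involutive {rim s}         refl = refl
  mate-involutive {gad s zero}    refl = refl
  mate-involutive {gad s (suc j)} ()

  mate-irrefl : ∀ x → mate x ≢ inj₂ x
  mate-irrefl (rim s)         ()
  mate-irrefl (gad s zero)    ()
  mate-irrefl (gad s (suc j)) ()

  Adj-sym : ∀ u v → Adj u v → Adj v u
  Adj-sym hub      (inj₂ x) e                           = there (there (here (sym e)))
  Adj-sym (inj₂ x) hub      (there (there (here e)))    = sym e
  Adj-sym (inj₂ x) (inj₂ y) (here refl)                 = there (here (cong inj₂ (sym (pre-succ x))))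
  Adj-sym (inj₂ x) (inj₂ y) (there (here refl))         = here (cong inj₂ (sym (succ-pre x)))
  Adj-sym (inj₂ x) (inj₂ y) (there (there (here e)))    = there (there (here (sym (mate-involutive (sym e)))))

  Adj-irrefl : ∀ v → ¬ Adj v v
  Adj-irrefl (inj₂ x) (here e)                 = succ≢id x (sym (inj₂-injective e))
  Adj-irrefl (inj₂ x) (there (here e))         =
    succ≢id x (trans (cong succ (inj₂-injective e)) (succ-pre x))
  Adj-irrefl (inj₂ x) (there (there (here e))) = mate-irrefl x (sym e)

  module _ (P : X → Set) (P-succ : ∀ x → P x → P (succ x)) where

    rim-closed : ∀ s t → P (rim s) → P (rim t)
    rim-closed = next-closed (P ∘ rim) (P-succ ∘ rim)

    gad-closed : ∀ s i j → P (gad s i) → P (gad s j)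
    gad-closed s = next-closed (P ∘ gad s) (P-succ ∘ gad s)

    -- Every route goes around the own cycle, across a spoke and along the rim, never through the
    -- hub. Closure under `succ` alone suffices because the cycles close up.
    connected : (∀ x y → mate x ≡ inj₂ y → P x → P y) → ∀ x y → P x → P y
    connected P-mate x y = from-rim y ∘ to-rim x
      where
      to-rim : ∀ x → P x → P (rim zero)
      to-rim (rim s)   p = rim-closed s zero p
      to-rim (gad s j) p = rim-closed s zero (P-mate _ _ refl (gad-closed s j zero p))

      from-rim : ∀ y → P (rim zero) → P y
      from-rim (rim s)   p = rim-closed zero s p
      from-rim (gad s j) p = gad-closed s zero j (P-mate _ _ refl (rim-closed zero s p))

  InGadget : Fin (3 + ρ) → V → Set
  InGadget s hub              = ⊥
  InGadget s (inj₂ (rim t))   = ⊥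
  InGadget s (inj₂ (gad t j)) = s ≡ t

  InGadget? : ∀ s v → Dec (InGadget s v)
  InGadget? s hub              = no λ ()
  InGadget? s (inj₂ (rim t))   = no λ ()
  InGadget? s (inj₂ (gad t j)) = s ≟ t

  -- The two cycle edges at a gadget vertex stay inside, so only the edge to its mate can leave.
  gadget-exits : ∀ s u v → Adj u v → InGadget s u → ¬ InGadget s v →
                 v ≡ hub ⊎ (u ≡ inj₂ (gad s zero) × v ≡ inj₂ (rim s))
  gadget-exits s (inj₂ (gad s j))       v (here refl)                 refl out = contradiction refl out
  gadget-exits s (inj₂ (gad s j))       v (there (here refl))         refl out = contradiction refl out
  gadget-exits s (inj₂ (gad s zero))    v (there (there (here refl))) refl out = inj₂ (refl , refl)
  gadget-exits s (inj₂ (gad s (suc j))) v (there (there (here refl))) refl out = inj₁ refl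

  spoke : X → Fin (3 + ρ)
  spoke (rim s)   = s
  spoke (gad s j) = s

  -- The value at `hub` is arbitrary; `InGadget-spoke` concerns gadget vertices only.
  spokeᵛ : V → Fin (3 + ρ)
  spokeᵛ hub      = zero
  spokeᵛ (inj₂ x) = spoke x

  InGadget-spoke : ∀ {s} v → InGadget s v → s ≡ spokeᵛ v
  InGadget-spoke (inj₂ (gad t j)) refl = refl

  -- The rim vertex is included, so that together these lists cover all edges.
  non-tips : Fin (3 + ρ) → List X
  non-tips s = rim s ∷ map (λ j → gad s (suc j)) (allFin (2 + w s))

  length-non-tips : ∀ s → length (non-tips s) ≡ 3 + w s
  length-non-tips s = cong suc (trans (length-map _ (allFin (2 + w s))) (length-tabulate {n = 2 + w s} (λ i → i)))

  gad-non-tip : ∀ s j → gad s (suc j) ∈ non-tips s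
  gad-non-tip s j = there (∈-map⁺ (λ j → gad s (suc j)) (∈-allFin j))

  NonTipAt : V → Set
  NonTipAt v = ∃ λ x → v ≡ inj₂ x × x ∈ non-tips (spoke x)

  -- The remaining vertices, the hub and the tips, are independent: both cycle neighbours of a tip
  -- are non-tips and its mate is on the rim.
  non-tip-end : ∀ u v → Adj u v → NonTipAt u ⊎ NonTipAt v
  non-tip-end (inj₂ (rim s))         v _ = inj₁ (_ , refl , here refl)
  non-tip-end (inj₂ (gad s (suc j))) v _ = inj₁ (_ , refl , gad-non-tip s j)
  non-tip-end hub (inj₂ (gad s (suc j))) _ = inj₂ (_ , refl , gad-non-tip s j)
  non-tip-end (inj₂ (gad s zero)) v (here refl)                 = inj₂ (_ , refl , gad-non-tip s _)
  non-tip-end (inj₂ (gad s zero)) v (there (here refl))         = inj₂ (_ , refl , gad-non-tip s _)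
  non-tip-end (inj₂ (gad s zero)) v (there (there (here refl))) = inj₂ (_ , refl , here refl)

  -- Transfer to `Fin n` and the lower bound on the chromatic number.

  module Realisation {n : ℕ} (enum : Fin n ↔ V) where
    open Inverse enum using () renaming (to to f; from to g; strictlyInverseˡ to f-g; strictlyInverseʳ to g-f)

    f-injective : ∀ {u v} → f u ≡ f v → u ≡ v
    f-injective eq = trans (sym (g-f _)) (trans (cong g eq) (g-f _))

    G : Graph n
    G = record
      { adj    = λ u v → ⌊ Adj? (f u) (f v) ⌋
      ; sym    = λ u v → adj-sym (f u) (f v)
      ; irrefl = λ v → adj-irrefl (f v)
      }
      where
      adj-sym : ∀ u v → ⌊ Adj? u v ⌋ ≡ ⌊ Adj? v u ⌋
      adj-sym u v with Adj? u v | Adj? v u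
      ... | yes _ | yes _ = refl
      ... | no _  | no _  = refl
      ... | yes a | no ¬a = contradiction (Adj-sym u v a) ¬a
      ... | no ¬a | yes a = contradiction (Adj-sym v u a) ¬a

      adj-irrefl : ∀ v → ⌊ Adj? v v ⌋ ≡ false
      adj-irrefl v with Adj? v v
      ... | yes a = ⊥-elim (Adj-irrefl v a)
      ... | no _  = refl

    Adj⁻ : ∀ {u v} → adj G u v ≡ true → Adj (f u) (f v)
    Adj⁻ {u} {v} = ⌊⌋-true⁻ (Adj? (f u) (f v))

    Adj⁺ : ∀ {u v} → Adj (f u) (f v) → adj G u v ≡ true
    Adj⁺ {u} {v} = ⌊⌋-true⁺ (Adj? (f u) (f v))

    Adj⁺-g : ∀ {u v} → Adj u v → adj G (g u) (g v) ≡ true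
    Adj⁺-g {u} {v} a = Adj⁺ (subst₂ Adj (sym (f-g u)) (sym (f-g v)) a)

    module Colouring (ρ-even : 2 ∣ ρ) (w-even : ∀ s → 2 ∣ w s) where

      not-3-colourable : ¬ Colorable G 3
      not-3-colourable (c , proper) = let s , eq = rim-hub-colour in
        proper′ {inj₂ (rim s)} {inj₂ (gad s zero)} (there (there (here refl))) (trans eq (sym (gad-hub-colour s)))
        where
        col : V → Fin 3
        col = c ∘ g

        proper′ : ∀ {u v} → Adj u v → col u ≢ col v
        proper′ a = proper _ _ (Adj⁺-g a)

        rim-hub-colour : ∃ λ s → col (inj₂ (rim s)) ≡ col hub
        rim-hub-colour = odd-cycle-uses-every-colour ρ-even (col ∘ inj₂ ∘ rim)
          (λ s → proper′ {inj₂ (rim s)} (here refl)) (col hub)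

        gad-hub-colour : ∀ s → col (inj₂ (gad s zero)) ≡ col hub
        gad-hub-colour s with odd-cycle-uses-every-colour (w-even s) (col ∘ inj₂ ∘ gad s)
                                (λ j → proper′ {inj₂ (gad s j)} (here refl)) (col hub)
        ... | zero  , eq = eq
        ... | suc j , eq = ⊥-elim (proper′ {hub} {inj₂ (gad s (suc j))} refl (sym eq))

      not-colourable : ∀ j → j < 4 → ¬ Colorable G j
      not-colourable j j<4 (c , proper) = not-3-colourable
        ((λ v → inject≤ (c v) (s≤s⁻¹ j<4)) ,
         λ u v uv eq → proper u v uv (inject≤-injective _ _ (c u) (c v) eq))

    -- Subgraphs of minimum degree 3, and criticality.

    module _ (H : Subgraph G) (min-degree-3 : ∀ v → vs H v ≡ true → 3 ≤ degree H v) where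

      -- If the edge were missing, `v` together with the at least three `H`-neighbours of `u` would
      -- be four distinct vertices among the three in `nbrs x`.
      es-full : ∀ u v x → f u ≡ inj₂ x → vs H u ≡ true → f v ∈ nbrs x → es H u v ≡ true
      es-full u v x fu u∈H v∈ = decidable-stable (es H u v ≟ᵇ true) λ ¬uv → contradiction
        (unique-length-≤ {R = λ a b → f a ≡ b} (λ p q → f-injective (trans p (sym q))) (nbrs x)
          (∉⇒Unique-∷ (¬uv ∘ ∈-filterᵇ⁻ (es H u)) (filterᵇ-Unique (es H u)))
          λ { {a} (here refl) → f a , v∈ , refl
            ; {a} (there a∈)  → f a , Adj⇒nbr fu (Adj⁻ (es⊆E H u a (∈-filterᵇ⁻ (es H u) a∈))) , refl })
        (<⇒≱ (s≤s (min-degree-3 u u∈H)))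

      private
        P : X → Set
        P x = vs H (g (inj₂ x)) ≡ true

        es-full-g : ∀ x v → P x → v ∈ nbrs x → es H (g (inj₂ x)) (g v) ≡ true
        es-full-g x v Px v∈ = es-full (g (inj₂ x)) (g v) x (f-g _) Px (subst (_∈ nbrs x) (sym (f-g v)) v∈)

        P-nbr : ∀ x y → inj₂ y ∈ nbrs x → P x → P y
        P-nbr x y y∈ Px = es-end′ H _ _ (es-full-g x (inj₂ y) Px y∈)

        one⇒all : ∀ x y → P x → P y
        one⇒all = connected P (λ x → P-nbr x _ (here refl))
                              (λ x y eq → P-nbr x y (there (there (here (sym eq)))))

        neighbour : ∀ v → vs H v ≡ true → ∃ λ u → es H v u ≡ true
        neighbour v v∈H with filterᵇ (es H v) (allFin n) | min-degree-3 v v∈H | ∈-filterᵇ⁻ (es H v)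
        ... | u ∷ _ | _ | mem = u , mem (here refl)

        -- If the given vertex is the hub, the minimum degree supplies a neighbour, which lies in
        -- `X`.
        some-P : NonEmpty H → ∃ P
        some-P (v , v∈H) with f v in fv
        ... | inj₂ x = x , subst (λ u → vs H u ≡ true) (trans (sym (g-f v)) (cong g fv)) v∈H
        ... | hub with neighbour v v∈H
        ...   | u , vu with f u in fu | subst (λ y → Adj y (f u)) fv (Adj⁻ (es⊆E H v u vu))
        ...     | inj₂ x | _ = x , subst (λ u → vs H u ≡ true) (trans (sym (g-f u)) (cong g fu)) (es-end′ H v u vu)

      spanning : NonEmpty H → ∀ v → vs H v ≡ true
      spanning ne v = subst (λ u → vs H u ≡ true) (g-f v) (all (f v))
        where
        allP : ∀ y → P y
        allP y = let x , Px = some-P ne in one⇒all x y Px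

        all : ∀ v → vs H (g v) ≡ true
        all (inj₂ x) = allP x
        -- The hub is reached last, as the mate of a non-tip.
        all hub      = es-end′ H _ _ (es-full-g (gad zero (suc zero)) hub (allP _) (there (there (here refl))))

      -- The hub is not adjacent to itself, so every edge has an end in `X`, where `es-full`
      -- applies.
      full : NonEmpty H → ∀ u v → adj G u v ≡ true → es H u v ≡ true
      full ne u v uv with f u in fu | f v in fv | Adj⁻ {u} {v} uv
      ... | inj₂ x | _      | a = es-full u v x fu (spanning ne u) (subst (_∈ nbrs x) (sym fv) a)
      ... | hub    | inj₂ y | a = trans (es-sym H u v)
        (es-full v u y fv (spanning ne v) (subst (_∈ nbrs y) (sym fu) (there (there (here (sym a))))))

    proper⇒2-degenerate : ∀ H → ProperSubgraph G H → TwoDegenerate H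
    proper⇒2-degenerate H proper H′ (v⊑ , e⊑) ne
      with any? (λ v → (vs H′ v ≟ᵇ true) ×-dec (degree H′ v ≤? 2))
    ... | yes found = found
    ... | no  none  = ⊥-elim (whole-not-proper proper)
      where
      min-degree-3 : ∀ v → vs H′ v ≡ true → 3 ≤ degree H′ v
      min-degree-3 v v∈ = ≰⇒> λ d≤2 → none (v , v∈ , d≤2)

      whole-not-proper : ¬ ProperSubgraph G H
      whole-not-proper (inj₁ (v , v∉))           = false≢true v∉ (v⊑ v (spanning H′ min-degree-3 ne v))
      whole-not-proper (inj₂ (u , v , uv , ¬uv)) = false≢true ¬uv (e⊑ u v (full H′ min-degree-3 ne u v uv))

    proper⇒3-colourable : ∀ H → ProperSubgraph G H → SubColorable H 3
    proper⇒3-colourable H proper = TwoDegenerate⇒3-colourable H (proper⇒2-degenerate H proper)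

    4-colourable : Colorable G 4
    4-colourable =
      let c , proper = proper⇒3-colourable (whole -ᵛ v) (inj₁ (v , -ᵛ-vs (whole {G = G}) v))
      in extend-colouring {G = G} whole v (inject₁ ∘ c) (λ u w uw → proper u w uw ∘ inject₁-injective)
           (fromℕ 3) (λ _ _ eq → fromℕ≢inject₁ (sym eq))
      where v = g hub

    K4-free : 4 < n → K4Free G
    K4-free 4<n (a , b , c , d , ab , ac , ad , bc , bd , cd) =
      contradiction (Unique-⊆⇒length-≤ {ys = allFin 3} colours-distinct (λ _ → ∈-allFin _)) (<⇒≱ ≤-refl)
      where
      K : List (Fin n)
      K = a ∷ b ∷ c ∷ d ∷ []

      v∉K : ∃ λ v → v ∉ K
      v∉K = fresh K 4<n

      v : Fin n
      v = proj₁ v∉K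

      colouring : SubColorable (whole {G = G} -ᵛ v) 3
      colouring = proper⇒3-colourable (whole -ᵛ v) (inj₁ (v , -ᵛ-vs (whole {G = G}) v))

      col : Fin n → Fin 3
      col = proj₁ colouring

      distinct : ∀ {x y} → x ∈ K → y ∈ K → adj G x y ≡ true → col x ≢ col y
      distinct {x} {y} x∈ y∈ xy = proj₂ colouring x y
        (-ᵛ-es {G = G} {whole} {v} {x} {y} (λ { refl → proj₂ v∉K x∈ }) (λ { refl → proj₂ v∉K y∈ }) xy)

      a∈ : a ∈ K
      a∈ = here refl
      b∈ : b ∈ K
      b∈ = there (here refl)
      c∈ : c ∈ K
      c∈ = there (there (here refl))
      d∈ : d ∈ K
      d∈ = there (there (there (here refl)))

      colours-distinct : Unique (col a ∷ col b ∷ col c ∷ col d ∷ [])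
      colours-distinct =
        (distinct a∈ b∈ ab ∷ distinct a∈ c∈ ac ∷ distinct a∈ d∈ ad ∷ []) ∷
        (distinct b∈ c∈ bc ∷ distinct b∈ d∈ bd ∷ []) ∷
        (distinct c∈ d∈ cd ∷ []) ∷ [] ∷ []

    -- Chords of a cycle and its passage through the hub.

    module Chords {l : ℕ} (len≥3′ : 3 ≤ 3 + l) (vertex : Fin (3 + l) → Fin n)
                  (vertex-inj : ∀ i j → vertex i ≡ vertex j → i ≡ j)
                  (vertex-edges : ∀ i j → isNext (3 + l) i j ≡ true → adj G (vertex i) (vertex j) ≡ true)
                  where

      -- Reassembled from separate fields so that the length is visibly `3 + l`, as `next` and
      -- `prev` require.
      C : Cycle G
      C = record { len = 3 + l ; len≥3 = len≥3′ ; vert = vertex ; inj = vertex-inj ; edges = vertex-edges }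

      at : Fin (3 + l) → V
      at = f ∘ vertex

      at-injective : ∀ {i j} → at i ≡ at j → i ≡ j
      at-injective = vertex-inj _ _ ∘ f-injective

      step : ∀ k → Adj (at k) (at (next k))
      step k = Adj⁻ (vertex-edges k (next k) (isNext-next k))

      step-back : ∀ k → Adj (at k) (at (prev k))
      step-back k = Adj-sym (at (prev k)) (at k) (subst (λ i → Adj (at (prev k)) (at i)) (next-prev k) (step (prev k)))

      next≢prev : ∀ (k : Fin (3 + l)) → next k ≢ prev k
      next≢prev k eq = next²≢id k (trans (cong next eq) (next-prev k))

      chord≢next : ∀ {k j} → Chord C k j → j ≢ next k
      chord≢next {k} (_ , nc) refl rewrite isNext-next k = contradiction nc λ ()

      chord≢prev : ∀ {k j} → Chord C k j → j ≢ prev k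
      chord≢prev {k} {j} ch refl = chord≢next (Chord-sym C {k} {j} ch) (sym (next-prev k))

      module _ {k x} (at-k : at k ≡ inj₂ x) where

        -- The two cycle neighbours and the far end of the chord are three distinct neighbours of a
        -- vertex of degree 3, hence all of them.
        nbrs-at-chord : ∀ {j v} → Chord C k j → v ∈ nbrs x → v ∈ at (next k) ∷ at (prev k) ∷ at j ∷ []
        nbrs-at-chord {j} {v} ch v∈ = decidable-stable (v ∈? _) λ v∉ → contradiction
          (Unique-⊆⇒length-≤ (∉⇒Unique-∷ v∉
            ((next≢prev k ∘ at-injective ∷ chord≢next ch ∘ sym ∘ at-injective ∷ []) ∷
             (chord≢prev ch ∘ sym ∘ at-injective ∷ []) ∷ [] ∷ []))
            λ { (here refl)                         → v∈
              ; (there (here refl))                 → Adj⇒nbr at-k (step k)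
              ; (there (there (here refl)))         → Adj⇒nbr at-k (step-back k)
              ; (there (there (there (here refl)))) → Adj⇒nbr at-k (Adj⁻ (proj₁ ch)) })
          (<⇒≱ ≤-refl)
          where open DecMembership _≟ᵛ_ using (_∈?_)

        chord-unique : ∀ {i j} → Chord C k i → Chord C k j → i ≡ j
        chord-unique {i} {j} chᵢ chⱼ
          with nbrs-at-chord chⱼ (Adj⇒nbr at-k (Adj⁻ (proj₁ chᵢ)))
        ... | here eq                 = contradiction (at-injective eq) (chord≢next chᵢ)
        ... | there (here eq)         = contradiction (at-injective eq) (chord≢prev chᵢ)
        ... | there (there (here eq)) = at-injective eq

        nbrs-on-cycle : ∀ {j v} → Chord C k j → v ∈ nbrs x → ∃ λ i → at i ≡ v
        nbrs-on-cycle ch v∈ with nbrs-at-chord ch v∈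
        ... | here eq                 = _ , sym eq
        ... | there (here eq)         = _ , sym eq
        ... | there (there (here eq)) = _ , sym eq

      hub-meets-gadget : ∀ s i j → InGadget s (at i) → ¬ InGadget s (at j) →
        ∃ λ p → at p ≡ hub × (InGadget s (at (next p)) ⊎ InGadget s (at (prev p)))
      hub-meets-gadget s i j in-i out-j
        with exit (InGadget? s ∘ at) i j in-i out-j
           | exit (¬? ∘ InGadget? s ∘ at) j i out-j (λ out-i → out-i in-i)
      ... | k , in-k , out-k | k′ , out-k′ , in-k′
        with gadget-exits s _ _ (step k) in-k out-k
           | gadget-exits s _ _ (Adj-sym _ _ (step k′)) (decidable-stable (InGadget? s _) in-k′) out-k′
      ...   | inj₁ eq | _ = next k , eq , inj₂ (subst (InGadget s ∘ at) (sym (prev-next k)) in-k)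
      ...   | inj₂ _ | inj₁ eq = k′ , eq , inj₁ (decidable-stable (InGadget? s _) in-k′)
      -- If the exit and the entry both used the spoke edge, then `next k` would be `k′` and
      -- `next k′` would be `k`, a cycle of length 2.
      ...   | inj₂ (tip , top) | inj₂ (tip′ , top′) = contradiction
              (trans (cong next (at-injective (trans top (sym top′)))) (at-injective (trans tip′ (sym tip))))
              (next²≢id k)

      -- The chord puts `mate x` on the cycle, and `x` and `mate x` lie on opposite sides of the
      -- boundary of the gadget at `spoke x`.
      chord⇒hub-meets-gadget : ∀ {k j x} → at k ≡ inj₂ x → Chord C k j →
        ∃ λ p → at p ≡ hub × (InGadget (spoke x) (at (next p)) ⊎ InGadget (spoke x) (at (prev p)))
      chord⇒hub-meets-gadget {k} {x = rim s} at-k ch =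
        let i , at-i = nbrs-on-cycle at-k ch (there (there (here refl)))
        in hub-meets-gadget s i k (subst (InGadget s) (sym at-i) refl) (subst (InGadget s) at-k)
      chord⇒hub-meets-gadget {k} {x = gad s zero} at-k ch =
        let i , at-i = nbrs-on-cycle at-k ch (there (there (here refl)))
        in hub-meets-gadget s k i (subst (InGadget s) (sym at-k) refl) (subst (InGadget s) at-i)
      chord⇒hub-meets-gadget {k} {x = gad s (suc _)} at-k ch =
        let i , at-i = nbrs-on-cycle at-k ch (there (there (here refl)))
        in hub-meets-gadget s k i (subst (InGadget s) (sym at-k) refl) (subst (InGadget s) at-i)

      module _ (w≤2 : ∀ s → w s ≤ 2) where

        chords-≤-10 : chords G C ≤ 10
        chords-≤-10 with any? (λ p → at p ≟ᵛ hub)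
        -- A cycle missing the hub has no chord at all, so the empty list covers.
        ... | no hub∉C = ≤-trans (chords-≤-length C [] cover λ ()) z≤n
          where
          cover : ∀ {i j} → Chord C i j → vertex i ∈ [] ⊎ vertex j ∈ []
          cover {i} {j} ch with non-tip-end (at i) (at j) (Adj⁻ (proj₁ ch))
          ... | inj₁ (x , at-i , _) = let p , at-p , _ = chord⇒hub-meets-gadget at-i ch in
                contradiction (p , at-p) hub∉C
          ... | inj₂ (x , at-j , _) = let p , at-p , _ = chord⇒hub-meets-gadget at-j (Chord-sym C ch) in
                contradiction (p , at-p) hub∉C
        ... | yes (p , at-p) = ≤-trans (chords-≤-length C Z cover unique) Z-length
          where
          a b : Fin (3 + ρ)
          a = spokeᵛ (at (next p))
          b = spokeᵛ (at (prev p))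

          Z : List (Fin n)
          Z = map (g ∘ inj₂) (non-tips a ++ non-tips b)

          Z-length : length Z ≤ 10
          Z-length = subst (_≤ 10)
            (sym (trans (length-map (g ∘ inj₂) (non-tips a ++ non-tips b))
              (trans (length-++ (non-tips a)) (cong₂ _+_ (length-non-tips a) (length-non-tips b)))))
            (+-mono-≤ (s≤s (s≤s (s≤s (w≤2 a)))) (s≤s (s≤s (s≤s (w≤2 b)))))

          at-chord : ∀ {i j x} → at i ≡ inj₂ x → x ∈ non-tips (spoke x) → Chord C i j → vertex i ∈ Z
          at-chord {i} {x = x} at-i x∈ ch with chord⇒hub-meets-gadget at-i ch
          -- The cycle visits the hub only once, so the passage found is the one at `p` and the
          -- gadget is that of `a` or of `b`.
          ... | p′ , at-p′ , meets with refl ← at-injective (trans at-p′ (sym at-p)) =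
            subst (_∈ Z) (trans (cong g (sym at-i)) (g-f (vertex i))) (∈-map⁺ (g ∘ inj₂) (side meets))
            where
            side : InGadget (spoke x) (at (next p)) ⊎ InGadget (spoke x) (at (prev p)) →
                   x ∈ non-tips a ++ non-tips b
            side (inj₁ y) = ∈-++⁺ˡ (subst (λ s → x ∈ non-tips s) (InGadget-spoke _ y) x∈)
            side (inj₂ y) = ∈-++⁺ʳ (non-tips a) (subst (λ s → x ∈ non-tips s) (InGadget-spoke _ y) x∈)

          cover : ∀ {i j} → Chord C i j → vertex i ∈ Z ⊎ vertex j ∈ Z
          cover {i} {j} ch with non-tip-end (at i) (at j) (Adj⁻ (proj₁ ch))
          ... | inj₁ (x , at-i , x∈) = inj₁ (at-chord at-i x∈ ch)
          ... | inj₂ (x , at-j , x∈) = inj₂ (at-chord at-j x∈ (Chord-sym C ch))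

          unique : ∀ {k i j} → vertex k ∈ Z → Chord C k i → Chord C k j → i ≡ j
          unique k∈ with x , _ , eq ← ∈-map⁻ (g ∘ inj₂) k∈ = chord-unique (trans (cong f eq) (f-g (inj₂ x)))

    chords-bounded : (∀ s → w s ≤ 2) → ∀ C → chords G C ≤ 10
    chords-bounded w≤2 record { len = suc (suc (suc l)) ; len≥3 = len≥3′ ; vert = vertex ; inj = vertex-inj ; edges = e } =
      Chords.chords-≤-10 len≥3′ vertex vertex-inj e w≤2
    chords-bounded w≤2 record { len = suc zero ; len≥3 = s≤s () }
    chords-bounded w≤2 record { len = suc (suc zero) ; len≥3 = s≤s (s≤s ()) }

-- Gadget lengths and the number of vertices.

Σ-suc↔⊎ : ∀ {n} {A : Fin (suc n) → Set} → (A zero ⊎ Σ (Fin n) (A ∘ suc)) ↔ Σ (Fin (suc n)) A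
Σ-suc↔⊎ = mk↔ₛ′
  (λ { (inj₁ a) → zero , a ; (inj₂ (i , a)) → suc i , a })
  (λ { (zero , a) → inj₁ a ; (suc i , a) → inj₂ (i , a) })
  (λ { (zero , a) → refl ; (suc i , a) → refl })
  (λ { (inj₁ a) → refl ; (inj₂ (i , a)) → refl })

sum↔Σ : ∀ {n} (g : Fin n → ℕ) → Fin (sum (tabulate g)) ↔ Σ (Fin n) (Fin ∘ g)
sum↔Σ {zero}  g = mk↔ₛ′ (λ ()) (λ ()) (λ ()) (λ ())
sum↔Σ {suc n} g = ↔-trans +↔⊎ (↔-trans (↔-refl ⊎-↔ sum↔Σ (g ∘ suc)) Σ-suc↔⊎)

alternating : ℕ → ℕ
alternating zero          = 0
alternating (suc zero)    = 2
alternating (suc (suc k)) = alternating k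

-- Gadgets of length 3 and 5 alternate after five of length 5; this makes the
-- number of gadgets odd and the number of vertices 20m + 31.
width : ℕ → ℕ
width (suc (suc (suc (suc (suc k))))) = alternating k
width _                               = 2

alternating-even : ∀ k → 2 ∣ alternating k
alternating-even zero          = divides 0 refl
alternating-even (suc zero)    = divides 1 refl
alternating-even (suc (suc k)) = alternating-even k

alternating-≤2 : ∀ k → alternating k ≤ 2
alternating-≤2 zero          = z≤n
alternating-≤2 (suc zero)    = ≤-refl
alternating-≤2 (suc (suc k)) = alternating-≤2 k

width-even : ∀ k → 2 ∣ width k
width-even 0 = divides 1 refl
width-even 1 = divides 1 refl
width-even 2 = divides 1 refl
width-even 3 = divides 1 refl
width-even 4 = divides 1 refl
width-even (suc (suc (suc (suc (suc k))))) = alternating-even k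

width-≤2 : ∀ k → width k ≤ 2
width-≤2 0 = ≤-refl
width-≤2 1 = ≤-refl
width-≤2 2 = ≤-refl
width-≤2 3 = ≤-refl
width-≤2 4 = ≤-refl
width-≤2 (suc (suc (suc (suc (suc k))))) = alternating-≤2 k

-- Four consecutive gadgets have lengths 3, 5, 3, 5, together 16.
sum-alternating : ∀ m → sum (tabulate {n = m * 4} (λ s → 3 + alternating (toℕ s))) ≡ m * 16
sum-alternating zero    = refl
sum-alternating (suc m) = cong (16 +_) (sum-alternating m)

module _ (m : ℕ) where

  private
    w : Fin (5 + m * 4) → ℕ
    w s = width (toℕ s)

  open Wheel (2 + m * 4) w using (V)

  order-V : 1 + (5 + m * 4 + sum (tabulate (λ s → 3 + w s))) ≡ 20 * m + 31
  -- The hub, `5 + m * 4` rim vertices, 25 vertices in the first five gadgets and `m * 16` in the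
  -- others.
  order-V = trans (cong (λ k → 1 + (5 + m * 4 + (25 + k))) (sum-alternating m))
    (solve 1 (λ m → con 1 :+ (con 5 :+ m :* con 4 :+ (con 25 :+ m :* con 16)) := con 20 :* m :+ con 31) refl m)
    where open +-*-Solver

  enumeration : Fin (20 * m + 31) ↔ V
  enumeration = subst (λ k → Fin k ↔ V) order-V
    (↔-trans +↔⊎ (1↔⊤ ⊎-↔ ↔-trans +↔⊎ (↔-refl ⊎-↔ sum↔Σ (λ s → 3 + w s))))

theorem4p1 : (m : ℕ) → 1 ≤ m →
    Σ (Graph (20 * m + 31)) λ G →
    K4Free G
    × HasChromaticNumber G 4
    × (∀ (H : Subgraph G) → ProperSubgraph G H → SubColorable H 3 × TwoDegenerate H)
    × (∀ (C : Cycle G) → chords G C ≤ 10)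
theorem4p1 m _ =
    G
  , K4-free (≤-trans (s≤s (s≤s (s≤s (s≤s (s≤s z≤n))))) (m≤n+m 31 (20 * m)))
  , (4-colourable , not-colourable (divides (suc (m * 2)) even) (width-even ∘ toℕ))
  , (λ H proper → proper⇒3-colourable H proper , proper⇒2-degenerate H proper)
  , chords-bounded (width-≤2 ∘ toℕ)
  where
  -- The rim has length `3 + (2 + m * 4)`, which is odd.
  open Wheel (2 + m * 4) (λ s → width (toℕ s))
  open Realisation (enumeration m)
  open Colouring
  even : 2 + m * 4 ≡ suc (m * 2) * 2
  even = cong (2 +_) (sym (*-assoc m 2 2))
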